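{- Let $G$ be a graph with $\chi'_{\mathrm{inj}}(G)=k$. Then $\chi_{st}(G)\leq 2^k$.
   Context: All graphs are finite and simple. A star coloring of $G$ is a proper vertex coloring of $G$ such that the union of any two color classes induces a star forest in $G$, i.e. every component of the induced subgraph is a star. The star chromatic number $\chi_{st}(G)$ is the smallest integer $k$ for which $G$ admits a star coloring with $k$ colors. Three edges $e_1,e_2,e_3$ of a graph are consecutive if they form (in this order) a path of length three or a cycle of length three. An injective edge-coloring of $G$ with $k$ colors is a map $c:E(G)\to\{1,\dots,k\}$ (not necessarily a proper edge-coloring) such that $c(e_1)\neq c(e_3)$ whenever $e_1,e_2,e_3$ are consecutive edges in $G$. The injective chromatic index $\chi'_{\mathrm{inj}}(G)$ is the minimum $k$ such that $G$ has an injective edge-coloring with $k$ colors. -}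

module Defs where

open import Data.Bool.Base using (Bool; T; false)
open import Data.Fin.Base using (Fin; _<_)
open import Data.List.Base using ([]; _∷_)
open import Data.List.Relation.Unary.Unique.Propositional using (Unique)
open import Data.Nat.Base using (ℕ; _≤_)
open import Data.Product.Base using (_×_; Σ-syntax; ∃-syntax)
open import Data.Sum.Base using (_⊎_)
open import Function.Bundles using (_⇔_)
open import Level using (0ℓ)
open import Relation.Binary.Core using (Rel)
open import Relation.Binary.Construct.Closure.ReflexiveTransitive using (Star)
open import Relation.Binary.PropositionalEquality.Core using (_≡_; _≢_)
open import Relation.Unary using (Pred; _∈_; _∪_)

record Graph : Set where
  field
    order      : ℕ
    adj        : Fin order → Fin order → Bool
    adj-sym    : ∀ u v → adj u v ≡ adj v u
    adj-irrefl : ∀ v → adj v v ≡ false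

  Vertex : Set
  Vertex = Fin order

  infix 4 _~_
  _~_ : Rel Vertex 0ℓ
  u ~ v = T (adj u v)

  -- Storing the smaller endpoint first makes each undirected edge have
  -- exactly one representative (_<_ and _~_ are proof-irrelevant).
  record Edge : Set where
    constructor mkEdge
    field
      {lo hi} : Vertex
      lo<hi   : lo < hi
      lo~hi   : lo ~ hi

  Joins : Edge → Vertex → Vertex → Set
  Joins e u v = (lo ≡ u × hi ≡ v) ⊎ (lo ≡ v × hi ≡ u)
    where open Edge e

module _ (G : Graph) where
  open Graph G

  InducedAdj : Pred Vertex 0ℓ → Rel Vertex 0ℓ
  InducedAdj S u v = u ∈ S × v ∈ S × u ~ v

  -- Vertex set of the component of G[S] containing v, for v ∈ S; `Star` is
  -- the library's reflexive-transitive closure, unrelated to star graphs.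
  Component : Pred Vertex 0ℓ → Vertex → Pred Vertex 0ℓ
  Component S v = Star (InducedAdj S) v

  -- G[C] is a star K₁,ₘ with centre c, where m = 0 (a single vertex) is allowed.
  InducesStar : Pred Vertex 0ℓ → Set
  InducesStar C =
    ∃[ c ] c ∈ C ×
      (∀ u v → u ∈ C → v ∈ C →
        u ~ v ⇔ ((u ≡ c × v ≢ c) ⊎ (u ≢ c × v ≡ c)))

  InducesStarForest : Pred Vertex 0ℓ → Set
  InducesStarForest S = ∀ v → v ∈ S → InducesStar (Component S v)

  IsProper : ∀ {k} → (Vertex → Fin k) → Set
  IsProper f = ∀ u v → u ~ v → f u ≢ f v

  ColorClass : ∀ {k} → (Vertex → Fin k) → Fin k → Pred Vertex 0ℓ
  ColorClass f i v = f v ≡ i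

  IsStarColoring : ∀ {k} → (Vertex → Fin k) → Set
  IsStarColoring f =
    IsProper f ×
    (∀ i j → i ≢ j → InducesStarForest (ColorClass f i ∪ ColorClass f j))

  StarColorable : ℕ → Set
  StarColorable k = Σ[ f ∈ (Vertex → Fin k) ] IsStarColoring f

  FormPath : Edge → Edge → Edge → Set
  FormPath e₁ e₂ e₃ =
    ∃[ a ] ∃[ b ] ∃[ c ] ∃[ d ] Unique (a ∷ b ∷ c ∷ d ∷ []) ×
      Joins e₁ a b × Joins e₂ b c × Joins e₃ c d

  FormTriangle : Edge → Edge → Edge → Set
  FormTriangle e₁ e₂ e₃ =
    ∃[ a ] ∃[ b ] ∃[ c ] Unique (a ∷ b ∷ c ∷ []) ×
      Joins e₁ a b × Joins e₂ b c × Joins e₃ c a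

  Consecutive : Edge → Edge → Edge → Set
  Consecutive e₁ e₂ e₃ = FormPath e₁ e₂ e₃ ⊎ FormTriangle e₁ e₂ e₃

  IsInjectiveEdgeColoring : ∀ {k} → (Edge → Fin k) → Set
  IsInjectiveEdgeColoring c =
    ∀ e₁ e₂ e₃ → Consecutive e₁ e₂ e₃ → c e₁ ≢ c e₃

  InjectivelyEdgeColorable : ℕ → Set
  InjectivelyEdgeColorable k = Σ[ c ∈ (Edge → Fin k) ] IsInjectiveEdgeColoring c

IsLeast : Pred ℕ 0ℓ → Pred ℕ 0ℓ
IsLeast P k = k ∈ P × (∀ m → m ∈ P → k ≤ m)

-- The two invariants are relations (k is the invariant of G) rather than
-- functions Graph → ℕ; the value k is unique by antisymmetry of _≤_.
IsStarChromaticNumber : Graph → ℕ → Set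
IsStarChromaticNumber G = IsLeast (StarColorable G)

IsInjectiveChromaticIndex : Graph → ℕ → Set
IsInjectiveChromaticIndex G = IsLeast (InjectivelyEdgeColorable G)

{-# OPTIONS --safe #-}

-- In an injective edge-coloring, two vertices that are both covered by color i
-- and adjacent in G are joined by an edge of color i, and the edges of color i
-- form a star forest.  Choose a centre in each of these stars and color a vertex
-- by the set of those i for which it is a chosen centre.  An edge of color i has
-- exactly one centre, so the coloring is proper.  If a b c d were a two-colored
-- path and bc had color i with centre b, then d would be covered by color i as
-- well, hence cd would have color i and c, with its two i-neighbours b and d,
-- would be a centre too; the case of centre c is the reverse path.
module Submission where

open import Data.Bool.Base using (T)
open import Data.Bool.Properties using (T?; T-irrelevant)
open import Data.Empty using (⊥; ⊥-elim)
open import Data.Fin.Base using (Fin; zero; suc; _<_; funToFin; finToFun)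
open import Data.Fin.Properties
  using (_≟_; _<?_; any?; all?; <-cmp; <-asym; <-irrelevant; finToFun-funToFin)
open import Data.List.Relation.Unary.All using ([]; _∷_)
open import Data.List.Relation.Unary.AllPairs using ([]; _∷_)
open import Data.Nat.Base using (ℕ; _≤_; _^_)
import Data.Nat.Base as ℕ
open import Data.Nat.Induction using (<-rec)
open import Data.Nat.Properties using (anyUpTo?; ≮⇒≥; ≤-refl; ≤-trans; <⇒≤)
open import Data.Product.Base using (_×_; _,_; proj₁; proj₂; ∃-syntax)
open import Data.Sum.Base using (_⊎_; inj₁; inj₂; [_,_]′; swap)
open import Function.Base using (id)
open import Function.Bundles using (mk⇔; module Equivalence)
open import Level using (0ℓ)
open import Relation.Binary.Construct.Closure.ReflexiveTransitive
  using (Star; ε; _◅_; _◅◅_)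
open import Relation.Binary.Definitions using (tri<; tri≈; tri>)
open import Relation.Binary.PropositionalEquality
  using (_≡_; _≢_; _≗_; refl; sym; trans; cong; subst; ≢-sym)
open import Relation.Nullary using (¬_; Dec; yes; no; contradiction)
open import Relation.Nullary.Decidable using (map′; _×-dec_; _⊎-dec_; _→-dec_; ¬?)
open import Relation.Unary using (Pred; Decidable; _∈_; _∪_)
open import Defs

-- The theorem asserts that a star chromatic number exists. Constructively, the descent to a least
-- element relies on testing membership, hence the decision procedure for star colorability below.
least-below : {P : Pred ℕ 0ℓ} → Decidable P →
  ∀ n → n ∈ P → ∃[ m ] (IsLeast P m × m ≤ n)
least-below {P} P? = <-rec _ step
  where
  step : ∀ n → (∀ {m} → m ℕ.< n → m ∈ P → ∃[ l ] (IsLeast P l × l ≤ m)) →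
         n ∈ P → ∃[ l ] (IsLeast P l × l ≤ n)
  step n rec pn with anyUpTo? P? n
  ... | yes (m , m<n , pm) =
    let l , least , l≤m = rec m<n pm in l , least , ≤-trans l≤m (<⇒≤ m<n)
  ... | no ∄ = n , (pn , λ m pm → ≮⇒≥ λ m<n → ∄ (m , m<n , pm)) , ≤-refl

funToFin-injective : ∀ {m n} (f g : Fin m → Fin n) → funToFin f ≡ funToFin g → f ≗ g
funToFin-injective f g eq x =
  trans (sym (finToFun-funToFin f x))
    (trans (cong (λ h → finToFun h x) eq) (finToFun-funToFin g x))

indicator : {P : Set} → Dec P → Fin 2
indicator (yes _) = suc zero
indicator (no  _) = zero

indicator-transfer : {P Q : Set} (P? : Dec P) (Q? : Dec Q) →
  indicator P? ≡ indicator Q? → P → Q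
indicator-transfer _       (yes q) _ _ = q
indicator-transfer (no ¬p) (no _)  _ p = contradiction p ¬p

module _ (G : Graph) where
  open Graph G

  -- Adjacency and edges

  ~-sym : ∀ {u v} → u ~ v → v ~ u
  ~-sym {u} {v} = subst T (adj-sym u v)

  ~⇒≢ : ∀ {u v} → u ~ v → u ≢ v
  ~⇒≢ {u} u~u refl = subst T (adj-irrefl u) u~u

  _~?_ : ∀ u v → Dec (u ~ v)
  u ~? v = T? (adj u v)

  joining-edge : ∀ {u v} → u ~ v → ∃[ e ] Joins e u v
  joining-edge {u} {v} u~v with <-cmp u v
  ... | tri< u<v _ _ = mkEdge u<v u~v , inj₁ (refl , refl)
  ... | tri≈ _ u≡v _ = contradiction u≡v (~⇒≢ u~v)
  ... | tri> _ _ v<u = mkEdge v<u (~-sym u~v) , inj₂ (refl , refl)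

  Joins⇒~ : ∀ {e u v} → Joins e u v → u ~ v
  Joins⇒~ {mkEdge _ p} (inj₁ (refl , refl)) = p
  Joins⇒~ {mkEdge _ p} (inj₂ (refl , refl)) = ~-sym p

  Joins-sym : ∀ {e u v} → Joins e u v → Joins e v u
  Joins-sym = swap

  -- The smaller endpoint is stored first, so the mixed cases contradict asymmetry of `_<_`. This
  -- makes `Linked?` a check of a single edge.
  Joins-unique : ∀ {e e′ u v} → Joins e u v → Joins e′ u v → e ≡ e′
  Joins-unique {mkEdge p q} {mkEdge p′ q′} (inj₁ (refl , refl)) (inj₁ (refl , refl))
    rewrite <-irrelevant p p′ | T-irrelevant q q′ = refl
  Joins-unique {mkEdge p q} {mkEdge p′ q′} (inj₂ (refl , refl)) (inj₂ (refl , refl))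
    rewrite <-irrelevant p p′ | T-irrelevant q q′ = refl
  Joins-unique {mkEdge p _} {mkEdge p′ _} (inj₁ (refl , refl)) (inj₂ (refl , refl)) =
    contradiction p′ (<-asym p)
  Joins-unique {mkEdge p _} {mkEdge p′ _} (inj₂ (refl , refl)) (inj₁ (refl , refl)) =
    contradiction p′ (<-asym p)

  -- Star colorings as proper colorings without two-colored P₄

  -- Properness forces a ≢ d, so a b c d is a path unless a ≡ c or b ≡ d.
  NoBicoloredP₄ : ∀ {k} → (Vertex → Fin k) → Set
  NoBicoloredP₄ f = ∀ a b c d → a ~ b → b ~ c → c ~ d →
    f a ≡ f c → f b ≡ f d → a ≡ c ⊎ b ≡ d

  module _ (S : Pred Vertex 0ℓ) where

    -- A local form of being the centre of a star component: the neighbours of h in S are leaves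
    -- attached to h.
    IsHub : Pred Vertex 0ℓ
    IsHub h = ∀ x y → InducedAdj G S h x → InducedAdj G S x y → y ≡ h

    InducedAdj-sym : ∀ {u v} → InducedAdj G S u v → InducedAdj G S v u
    InducedAdj-sym (u∈S , v∈S , u~v) = v∈S , u∈S , ~-sym u~v

    Component-∈ : ∀ {v w} → v ∈ S → w ∈ Component G S v → w ∈ S
    Component-∈ v∈S ε                   = v∈S
    Component-∈ _   ((_ , w∈S , _) ◅ p) = Component-∈ w∈S p

    -- A walk from a hub is back at the hub after every second step.
    hub-component : ∀ {h} → IsHub h → ∀ {w} → w ∈ Component G S h →
      w ≡ h ⊎ InducedAdj G S h w
    hub-component hub ε       = inj₁ refl
    hub-component {h} hub (e ◅ p) = from-neighbour e p
      where
      from-neighbour : ∀ {x w} → InducedAdj G S h x → Star (InducedAdj G S) x w →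
        w ≡ h ⊎ InducedAdj G S h w
      from-neighbour e ε = inj₂ e
      from-neighbour e (e′ ◅ p) with refl ← hub _ _ e e′ = hub-component hub p

    hub⇒InducesStar : ∀ {v h} → v ∈ S → IsHub h →
      h ∈ Component G S v → v ∈ Component G S h → InducesStar G (Component G S v)
    hub⇒InducesStar {v} {h} v∈S hub v→h h→v = h , v→h , λ u w u∈C w∈C → mk⇔
      (λ u~w → to u∈C w∈C u~w)
      [ (λ { (refl , w≢h) → spoke w∈C w≢h })
      , (λ { (u≢h , refl) → ~-sym (spoke u∈C u≢h) }) ]′
      where
      around : ∀ {w} → w ∈ Component G S v → w ≡ h ⊎ InducedAdj G S h w
      around w∈C = hub-component hub (h→v ◅◅ w∈C)

      spoke : ∀ {w} → w ∈ Component G S v → w ≢ h → h ~ w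
      spoke w∈C w≢h with around w∈C
      ... | inj₁ w≡h           = contradiction w≡h w≢h
      ... | inj₂ (_ , _ , h~w) = h~w

      to : ∀ {u w} → u ∈ Component G S v → w ∈ Component G S v → u ~ w →
        (u ≡ h × w ≢ h) ⊎ (u ≢ h × w ≡ h)
      to u∈C w∈C u~w with around u∈C
      ... | inj₁ refl = inj₁ (refl , ≢-sym (~⇒≢ u~w))
      ... | inj₂ e@(_ , u∈S , h~u) =
        inj₂ (≢-sym (~⇒≢ h~u) , hub _ _ e (u∈S , Component-∈ v∈S w∈C , u~w))

    -- The centre of the component of v is the midpoint x of a walk v x y in S with y different from
    -- v, and v itself if there is no such walk.
    P₄-free⇒InducesStarForest : Decidable S →
      (∀ {a b c d} → InducedAdj G S a b → InducedAdj G S b c → InducedAdj G S c d →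
        a ≡ c ⊎ b ≡ d) →
      InducesStarForest G S
    P₄-free⇒InducesStarForest S? free v v∈S = by-cases extends?
      where
      InducedAdj? : ∀ u w → Dec (InducedAdj G S u w)
      InducedAdj? u w = S? u ×-dec S? w ×-dec (u ~? w)

      Extends : Set
      Extends = ∃[ x ] ∃[ y ] (InducedAdj G S v x × InducedAdj G S x y × y ≢ v)

      extends? : Dec Extends
      extends? = any? λ x → any? λ y →
        InducedAdj? v x ×-dec InducedAdj? x y ×-dec ¬? (y ≟ v)

      by-cases : Dec Extends → InducesStar G (Component G S v)
      by-cases (yes (x , y , vx , xy , y≢v)) =
        hub⇒InducesStar v∈S hub (vx ◅ ε) (InducedAdj-sym vx ◅ ε)
        where
        hub : IsHub x
        hub z w xz zw with z ≟ v
        ... | no z≢v = [ (λ v≡z → contradiction (sym v≡z) z≢v) , sym ]′ (free vx xz zw)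
        -- The walk v x z w backtracks here, so y x v w takes its place.
        ... | yes refl =
          [ (λ y≡v → contradiction y≡v y≢v) , sym ]′ (free (InducedAdj-sym xy) xz zw)
      by-cases (no ∄) = hub⇒InducesStar v∈S hub ε ε
        where
        hub : IsHub v
        hub x y vx xy with y ≟ v
        ... | yes y≡v = y≡v
        ... | no  y≢v = contradiction (x , y , vx , xy , y≢v) ∄

  module _ {k} (f : Vertex → Fin k) where

    NoBicoloredP₄⇒IsStarColoring : IsProper G f → NoBicoloredP₄ f → IsStarColoring G f
    NoBicoloredP₄⇒IsStarColoring proper free = proper , λ i j _ →
      P₄-free⇒InducesStarForest (ColorClass G f i ∪ ColorClass G f j)
        (λ v → (f v ≟ i) ⊎-dec (f v ≟ j))
        λ (a∈ , b∈ , a~b) (_ , c∈ , b~c) (_ , d∈ , c~d) →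
          free _ _ _ _ a~b b~c c~d
            (alternate a∈ b∈ c∈ (proper _ _ a~b) (proper _ _ b~c))
            (alternate b∈ c∈ d∈ (proper _ _ b~c) (proper _ _ c~d))
      where
      alternate : ∀ {i j x y z : Fin k} → x ≡ i ⊎ x ≡ j → y ≡ i ⊎ y ≡ j →
        z ≡ i ⊎ z ≡ j → x ≢ y → y ≢ z → x ≡ z
      alternate (inj₁ refl) _           (inj₁ refl) _   _   = refl
      alternate (inj₂ refl) _           (inj₂ refl) _   _   = refl
      alternate (inj₁ refl) (inj₁ refl) _           x≢y _   = contradiction refl x≢y
      alternate (inj₂ refl) (inj₂ refl) _           x≢y _   = contradiction refl x≢y
      alternate _           (inj₁ refl) (inj₁ refl) _   y≢z = contradiction refl y≢z
      alternate _           (inj₂ refl) (inj₂ refl) _   y≢z = contradiction refl y≢z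

    -- The walk a b c d lies in one component, a star with centre z, and each of its edges has
    -- exactly one end at z. So z is both a and c, or both b and d.
    IsStarColoring⇒NoBicoloredP₄ : IsStarColoring G f → NoBicoloredP₄ f
    IsStarColoring⇒NoBicoloredP₄ (proper , forest) a b c d a~b b~c c~d fa≡fc fb≡fd =
      conclude (centred ε b∈C a~b) (centred b∈C c∈C b~c) (centred c∈C d∈C c~d)
      where
      S = ColorClass G f (f a) ∪ ColorClass G f (f b)
      C = Component G S a

      star : InducesStar G C
      star = forest (f a) (f b) (proper a b a~b) a (inj₁ refl)

      z = proj₁ star

      centred : ∀ {u w} → u ∈ C → w ∈ C → u ~ w → (u ≡ z × w ≢ z) ⊎ (u ≢ z × w ≡ z)
      centred u∈C w∈C = Equivalence.to (proj₂ (proj₂ star) _ _ u∈C w∈C)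

      c∈S : c ∈ S
      c∈S = inj₁ (sym fa≡fc)

      b∈C : b ∈ C
      b∈C = (inj₁ refl , inj₂ refl , a~b) ◅ ε

      c∈C : c ∈ C
      c∈C = b∈C ◅◅ (inj₂ refl , c∈S , b~c) ◅ ε

      d∈C : d ∈ C
      d∈C = c∈C ◅◅ (c∈S , inj₂ (sym fb≡fd) , c~d) ◅ ε

      conclude : (a ≡ z × b ≢ z) ⊎ (a ≢ z × b ≡ z) → (b ≡ z × c ≢ z) ⊎ (b ≢ z × c ≡ z) →
        (c ≡ z × d ≢ z) ⊎ (c ≢ z × d ≡ z) → a ≡ c ⊎ b ≡ d
      conclude (inj₁ (a≡z , _))   (inj₂ (_ , c≡z))   _ = inj₁ (trans a≡z (sym c≡z))
      conclude (inj₁ (_ , b≢z))   (inj₁ (b≡z , _))   _ = contradiction b≡z b≢z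
      conclude (inj₂ (_ , b≡z))   (inj₂ (b≢z , _))   _ = contradiction b≡z b≢z
      conclude (inj₂ (_ , b≡z)) (inj₁ _) (inj₂ (_ , d≡z)) = inj₂ (trans b≡z (sym d≡z))
      conclude (inj₂ _) (inj₁ (_ , c≢z)) (inj₁ (c≡z , _)) = contradiction c≡z c≢z

    -- Components are defined by reachability, whereas the absence of two-colored paths is a finite
    -- check over four vertices.
    IsStarColoring? : Dec (IsStarColoring G f)
    IsStarColoring? = map′
      (λ (proper , free) → NoBicoloredP₄⇒IsStarColoring proper free)
      (λ star → proj₁ star , IsStarColoring⇒NoBicoloredP₄ star)
      ((all? λ u → all? λ v → (u ~? v) →-dec ¬? (f u ≟ f v))
        ×-dec
       (all? λ a → all? λ b → all? λ c → all? λ d →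
         (a ~? b) →-dec (b ~? c) →-dec (c ~? d) →-dec
         (f a ≟ f c) →-dec (f b ≟ f d) →-dec ((a ≟ c) ⊎-dec (b ≟ d))))

  -- For the search over coded colorings: decoding `funToFin f` recovers `f` only pointwise.
  IsStarColoring-resp-≗ : ∀ {k} {f g : Vertex → Fin k} → f ≗ g →
    IsStarColoring G f → IsStarColoring G g
  IsStarColoring-resp-≗ {f = f} {g} f≗g star@(proper , _) =
    NoBicoloredP₄⇒IsStarColoring g
      (λ u v u~v gu≡gv → proper u v u~v (back gu≡gv))
      (λ a b c d a~b b~c c~d ga≡gc gb≡gd →
        IsStarColoring⇒NoBicoloredP₄ f star a b c d a~b b~c c~d
          (back ga≡gc) (back gb≡gd))
    where
    back : ∀ {u v} → g u ≡ g v → f u ≡ f v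
    back eq = trans (f≗g _) (trans eq (sym (f≗g _)))

  StarColorable? : Decidable (StarColorable G)
  StarColorable? k = map′
    (λ (n , star) → finToFun n , star)
    (λ (f , star) → funToFin f ,
      IsStarColoring-resp-≗ (λ v → sym (finToFun-funToFin f v)) star)
    (any? λ n → IsStarColoring? (finToFun {k} {order} n))

  -- The star coloring given by an injective edge-coloring

  module _ {k} (col : Edge → Fin k) (injective : IsInjectiveEdgeColoring G col) where

    -- Stars formed by the edges of one color

    Linked : Fin k → Vertex → Vertex → Set
    Linked i u v = ∃[ e ] (Joins e u v × col e ≡ i)

    Linked? : ∀ i u v → Dec (Linked i u v)
    Linked? i u v with u ~? v
    ... | no ¬u~v = no λ (e , j , _) → ¬u~v (Joins⇒~ {e} j)
    ... | yes u~v = let e , j = joining-edge u~v in map′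
      (λ eq → e , j , eq)
      (λ (e′ , j′ , eq) → trans (cong col (Joins-unique j j′)) eq)
      (col e ≟ i)

    Linked-sym : ∀ {i u v} → Linked i u v → Linked i v u
    Linked-sym (e , j , eq) = e , Joins-sym {e} j , eq

    Linked⇒~ : ∀ {i u v} → Linked i u v → u ~ v
    Linked⇒~ (e , j , _) = Joins⇒~ {e} j

    -- The edges ab, bc, cd form a triangle if a = d and a path otherwise, so they are consecutive
    -- in either case.
    not-linked-twice : ∀ {i a b c d} → a ≢ c → b ≢ d → b ~ c →
      Linked i a b → Linked i c d → ⊥
    not-linked-twice {a = a} {b} {c} {d} a≢c b≢d b~c ab@(e₁ , j₁ , eq₁) cd@(e₃ , j₃ , eq₃) =
      injective e₁ e₂ e₃ consecutive (trans eq₁ (sym eq₃))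
      where
      e₂ = proj₁ (joining-edge b~c)
      j₂ = proj₂ (joining-edge b~c)
      a≢b = ~⇒≢ (Linked⇒~ ab)
      c≢d = ~⇒≢ (Linked⇒~ cd)
      b≢c = ~⇒≢ b~c

      consecutive : Consecutive G e₁ e₂ e₃
      consecutive with a ≟ d
      ... | yes refl = inj₂ (a , b , c ,
        (a≢b ∷ a≢c ∷ []) ∷ (b≢c ∷ []) ∷ [] ∷ [] , j₁ , j₂ , j₃)
      ... | no a≢d = inj₁ (a , b , c , d ,
        (a≢b ∷ a≢c ∷ a≢d ∷ []) ∷ (b≢c ∷ b≢d ∷ []) ∷ (c≢d ∷ []) ∷ [] ∷ [] ,
        j₁ , j₂ , j₃)

    -- Used for v linked to u in color i, where it means that u has degree at least two in that
    -- color.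
    HasOther : Fin k → Vertex → Vertex → Set
    HasOther i u v = ∃[ w ] (w ≢ v × Linked i u w)

    -- If the star is a single edge, its smaller endpoint is the chosen centre.
    Centre : Fin k → Vertex → Set
    Centre i u = ∃[ v ] (Linked i u v × (HasOther i u v ⊎ (u < v × ¬ HasOther i v u)))

    HasOther? : ∀ i u v → Dec (HasOther i u v)
    HasOther? i u v = any? λ w → ¬? (w ≟ v) ×-dec Linked? i u w

    Centre? : ∀ i u → Dec (Centre i u)
    Centre? i u = any? λ v →
      Linked? i u v ×-dec (HasOther? i u v ⊎-dec ((u <? v) ×-dec ¬? (HasOther? i v u)))

    -- Otherwise both outer edges of a walk w u v x would have color i. This is why the edges of
    -- color i form stars.
    ¬both-HasOther : ∀ {i u v} → Linked i u v → HasOther i u v → HasOther i v u → ⊥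
    ¬both-HasOther uv (_ , w≢v , uw) (_ , x≢u , vx) =
      not-linked-twice w≢v (≢-sym x≢u) (Linked⇒~ uv) (Linked-sym uw) vx

    branching⇒Centre : ∀ {i u v w} → v ≢ w → Linked i u v → Linked i u w → Centre i u
    branching⇒Centre v≢w uv uw = _ , uv , inj₁ (_ , ≢-sym v≢w , uw)

    -- The witness in `Centre i u` can only be v, so u is a centre through the tie-break alone.
    Centre-sole : ∀ {i u v} → ¬ HasOther i u v → Centre i u → u < v × ¬ HasOther i v u
    Centre-sole {i} {u} {v} ∄ (x , ux , why) with x ≟ v
    ... | no x≢v = contradiction (x , x≢v , ux) ∄
    ... | yes refl = [ (λ o → contradiction o ∄) , id ]′ why

    -- At most one end has a second neighbour in color i, and that end is the centre. If neither has
    -- one, the star is a single edge and the vertex order decides.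
    one-Centre : ∀ {i u v} → Linked i u v →
      (Centre i u × ¬ Centre i v) ⊎ (Centre i v × ¬ Centre i u)
    one-Centre {i} {u} {v} uv with HasOther? i u v | HasOther? i v u
    ... | yes ou | yes ov = ⊥-elim (¬both-HasOther uv ou ov)
    ... | yes ou | no ¬ov =
      inj₁ ((v , uv , inj₁ ou) , λ cv → proj₂ (Centre-sole ¬ov cv) ou)
    ... | no ¬ou | yes ov =
      inj₂ ((u , Linked-sym uv , inj₁ ov) , λ cu → proj₂ (Centre-sole ¬ou cu) ov)
    ... | no ¬ou | no ¬ov with <-cmp u v
    ...   | tri< u<v _ _ =
      inj₁ ((v , uv , inj₂ (u<v , ¬ov)) , λ cv → <-asym u<v (proj₁ (Centre-sole ¬ov cv)))
    ...   | tri≈ _ u≡v _ = contradiction u≡v (~⇒≢ (Linked⇒~ uv))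
    ...   | tri> _ _ v<u =
      inj₂ ((u , Linked-sym uv , inj₂ (v<u , ¬ou)) ,
            λ cu → <-asym v<u (proj₁ (Centre-sole ¬ou cu)))

    -- Some edge dx has color i. Since bc has color i too and c ~ d, injectivity forces x = c, and
    -- then c branches to b and d.
    Centre-at-distance-2 : ∀ {i b c d} → b ≢ d → Linked i b c → c ~ d →
      Centre i d → Centre i c
    Centre-at-distance-2 {c = c} b≢d bc c~d (x , dx , _) with c ≟ x
    ... | yes refl = branching⇒Centre b≢d (Linked-sym bc) (Linked-sym dx)
    ... | no c≢x   = ⊥-elim (not-linked-twice b≢d c≢x c~d bc dx)

    -- Coloring vertices by coded sets of edge colors

    centreSet : Vertex → Fin (2 ^ k)
    centreSet v = funToFin λ i → indicator (Centre? i v)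

    centreSet-transfer : ∀ {u v} → centreSet u ≡ centreSet v →
      ∀ {i} → Centre i u → Centre i v
    centreSet-transfer {u} {v} eq {i} =
      indicator-transfer (Centre? i u) (Centre? i v) (funToFin-injective _ _ eq i)

    ~⇒Linked : ∀ {u v} → u ~ v → ∃[ i ] Linked i u v
    ~⇒Linked u~v = let e , j = joining-edge u~v in col e , e , j , refl

    centreSet-IsProper : IsProper G centreSet
    centreSet-IsProper u v u~v eq with one-Centre (proj₂ (~⇒Linked u~v))
    ... | inj₁ (cu , ¬cv) = ¬cv (centreSet-transfer eq cu)
    ... | inj₂ (cv , ¬cu) = ¬cu (centreSet-transfer (sym eq) cv)

    centreSet-NoBicoloredP₄ : NoBicoloredP₄ centreSet
    centreSet-NoBicoloredP₄ a b c d a~b b~c c~d a≈c b≈d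
      with a ≟ c | b ≟ d | ~⇒Linked b~c
    ... | yes a≡c | _       | _ = inj₁ a≡c
    ... | no _    | yes b≡d | _ = inj₂ b≡d
    ... | no a≢c  | no b≢d  | _ , bc with one-Centre bc
    ...   | inj₁ (cb , ¬cc) = contradiction
      (Centre-at-distance-2 b≢d bc c~d (centreSet-transfer b≈d cb)) ¬cc
    -- Here a is a centre like c, and the walk c b a makes b a centre too.
    ...   | inj₂ (cc , ¬cb) = contradiction
      (Centre-at-distance-2 (≢-sym a≢c) (Linked-sym bc) (~-sym a~b)
        (centreSet-transfer (sym a≈c) cc)) ¬cb

    centreSet-IsStarColoring : IsStarColoring G centreSet
    centreSet-IsStarColoring =
      NoBicoloredP₄⇒IsStarColoring centreSet centreSet-IsProper centreSet-NoBicoloredP₄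

theorem1p8 : (G : Graph) (k : ℕ) → IsInjectiveChromaticIndex G k →
    ∃[ s ] (IsStarChromaticNumber G s × s ≤ 2 ^ k)
theorem1p8 G k ((col , injective) , _) =
  least-below (StarColorable? G) (2 ^ k)
    (centreSet G col injective , centreSet-IsStarColoring G col injective)
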